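{- Consider the following three assertions. (A) Every $5$-edge-connected essentially $6$-edge-connected graph is $\langle\mathbb{Z}_3\rangle$-extendable at each of its vertices of degree $5$. (B) Every $\langle\mathbb{Z}_3\rangle$-reduced graph has minimum degree at most $4$. (C) Every $5$-edge-connected graph is $\mathbb{Z}_3$-connected. Then each of the following holds: (i) (A) implies (B); (ii) (B) implies (C).
   Context: Graphs are finite, have no loops, and may have multiple edges. An edge cut $X=[S,V(G)-S]$ of a connected graph $G$ (the set of edges with exactly one end in $S$) is essential if at least two components of $G-X$ are nontrivial (have more than one vertex). A graph is essentially $k$-edge-connected if it has no essential edge cut with fewer than $k$ edges. For an orientation $D$, $d_D^+(v)$ and $d_D^-(v)$ denote the out-degree and in-degree of $v$. A zero-sum function of $G$ is a map $\beta: V(G)\to\mathbb{Z}_3$ with $\sum_{v\in V(G)}\beta(v)=0$ in $\mathbb{Z}_3$; a $\beta$-orientation of $G$ is an orientation $D$ of $G$ with $d_D^+(v)-d_D^-(v)=\beta(v)$ in $\mathbb{Z}_3$ for every $v\in V(G)$. $G$ is $\mathbb{Z}_3$-connected if it admits a $\beta$-orientation for every zero-sum function $\beta$ of $G$. A graph is $\langle\mathbb{Z}_3\rangle$-reduced if it has no nontrivial (more than one vertex) $\mathbb{Z}_3$-connected subgraph; in particular $K_1$ is $\langle\mathbb{Z}_3\rangle$-reduced. $E_G(z_0)$ is the set of edges incident with $z_0$; a pre-orientation $D_{z_0}$ of $E_G(z_0)$ is an orientation of just these edges. $G$ is $\langle\mathbb{Z}_3\rangle$-extendable at $z_0$ if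 for every zero-sum function $\beta$ of $G$ and every pre-orientation $D_{z_0}$ of $E_G(z_0)$ with $d_{D_{z_0}}^+(z_0)-d_{D_{z_0}}^-(z_0)\equiv\beta(z_0)\pmod 3$, $D_{z_0}$ can be extended to a $\beta$-orientation of $G$. -}

module Defs where

open import Data.Bool.Base using (Bool; if_then_else_)
open import Data.Fin.Base using (Fin; fromℕ<)
open import Data.Fin.Properties using (_≟_)
open import Data.Fin.Subset using (Subset; _∈_; _∉_; ∁; Nonempty)
open import Data.Fin.Subset.Properties using (_∈?_)
open import Data.Integer.Base as ℤ using (ℤ; +_; 0ℤ)
open import Data.Integer.Divisibility.Signed using (_∣_)
open import Data.List.Base using (map; allFin)
open import Data.List.Extrema.Nat using (min)
open import Data.Maybe.Base as Maybe using (Maybe; just)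
open import Data.Maybe using (Is-just)
open import Data.Maybe.Properties using (≡-dec)
open import Data.Nat.Base using (ℕ; _≤_; _<_)
open import Data.Product.Base using (∃-syntax; _×_)
open import Data.Sum.Base using (_⊎_)
open import Function.Base using (_∘_)
open import Function.Bundles using (_⇔_)
open import Function.Definitions using (Injective)
open import Level using (0ℓ)
open import Relation.Binary.Construct.Closure.ReflexiveTransitive using (Star)
open import Relation.Binary.PropositionalEquality using (_≡_; _≢_)
open import Relation.Nullary using (¬_; does; ¬?; _×-dec_; _⊎-dec_)
open import Relation.Unary using (Pred; Decidable)

import Data.Integer.Properties as ℤ
import Data.Nat.Properties as ℕ
import Algebra.Properties.CommutativeMonoid.Sum ℕ.+-0-commutativeMonoid as ℕΣ
import Algebra.Properties.CommutativeMonoid.Sum ℤ.+-0-commutativeMonoid as ℤΣ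

count : ∀ {n p} {P : Pred (Fin n) p} → Decidable P → ℕ
count P? = ℕΣ.sum λ i → if does (P? i) then 1 else 0

-- ℤ₃ is the setoid of integers under _≡₃_, so a map into ℤ₃ is given by an
-- integer-valued function and equations in ℤ₃ are read as _≡₃_.
infix 4 _≡₃_
_≡₃_ : ℤ → ℤ → Set
a ≡₃ b = + 3 ∣ a ℤ.- b

-- Edges are labelled, so parallel edges are allowed. The order of the two
-- ends of an edge is only a reference direction for describing orientations.
record Graph : Set where
  field
    order    : ℕ
    size     : ℕ
    nonempty : 0 < order
    end₁     : Fin size → Fin order
    end₂     : Fin size → Fin order
    loopless : ∀ e → end₁ e ≢ end₂ e

  Vertex : Set
  Vertex = Fin order

  Edge : Set
  Edge = Fin size

  Incident : Vertex → Edge → Set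
  Incident v e = end₁ e ≡ v ⊎ end₂ e ≡ v

  incident? : ∀ v → Decidable (Incident v)
  incident? v e = (end₁ e ≟ v) ⊎-dec (end₂ e ≟ v)

  degree : Vertex → ℕ
  degree v = count (incident? v)

  -- The first argument of min is only a default for the empty list; it is
  -- itself the degree of some vertex.
  minDegree : ℕ
  minDegree = min (degree (fromℕ< nonempty)) (map degree (allFin order))

  Joins : Edge → Vertex → Vertex → Set
  Joins e u v = (end₁ e ≡ u × end₂ e ≡ v) ⊎ (end₁ e ≡ v × end₂ e ≡ u)

  ----------------------------------------------------------------------
  -- Edge cuts

  -- e ∈ [S , V - S]
  Crosses : Subset order → Edge → Set
  Crosses S e = (end₁ e ∈ S × end₂ e ∉ S) ⊎ (end₁ e ∉ S × end₂ e ∈ S)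

  crosses? : ∀ S → Decidable (Crosses S)
  crosses? S e = ((end₁ e ∈? S) ×-dec ¬? (end₂ e ∈? S))
           ⊎-dec (¬? (end₁ e ∈? S) ×-dec (end₂ e ∈? S))

  cutSize : Subset order → ℕ
  cutSize S = count (crosses? S)

  Proper : Subset order → Set
  Proper S = Nonempty S × Nonempty (∁ S)

  AdjacentWithout : Pred Edge 0ℓ → Vertex → Vertex → Set
  AdjacentWithout X u v = ∃[ e ] ¬ X e × Joins e u v

  -- u and v lie in the same component of G - X
  SameComponent : Pred Edge 0ℓ → Vertex → Vertex → Set
  SameComponent X = Star (AdjacentWithout X)

  -- the component of G - X containing v has more than one vertex
  NontrivialComponent : Pred Edge 0ℓ → Vertex → Set
  NontrivialComponent X v = ∃[ w ] w ≢ v × SameComponent X v w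

  Essential : Pred Edge 0ℓ → Set
  Essential X = ∃[ u ] ∃[ v ]
    NontrivialComponent X u × NontrivialComponent X v × ¬ SameComponent X u v

  -- For k ≥ 1 connectedness is included: a disconnected graph has a proper
  -- S with cutSize S ≡ 0.
  EdgeConnected : ℕ → Set
  EdgeConnected k = ∀ S → Proper S → k ≤ cutSize S

  EssentiallyEdgeConnected : ℕ → Set
  EssentiallyEdgeConnected k =
    ∀ S → Proper S → Essential (Crosses S) → k ≤ cutSize S

  ----------------------------------------------------------------------
  -- Orientations

  -- true directs e from end₁ e to end₂ e, false the other way;
  -- nothing leaves e undirected.
  Orientation : Set
  Orientation = Edge → Bool

  PartialOrientation : Set
  PartialOrientation = Edge → Maybe Bool

  total : Orientation → PartialOrientation
  total D = just ∘ D

  tail : PartialOrientation → Edge → Maybe Vertex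
  tail P e = Maybe.map (λ b → if b then end₁ e else end₂ e) (P e)

  head : PartialOrientation → Edge → Maybe Vertex
  head P e = Maybe.map (λ b → if b then end₂ e else end₁ e) (P e)

  outDegree : PartialOrientation → Vertex → ℕ
  outDegree P v = count λ e → ≡-dec _≟_ (tail P e) (just v)

  inDegree : PartialOrientation → Vertex → ℕ
  inDegree P v = count λ e → ≡-dec _≟_ (head P e) (just v)

  netDegree : PartialOrientation → Vertex → ℤ
  netDegree P v = + outDegree P v ℤ.- + inDegree P v

  Extends : Orientation → PartialOrientation → Set
  Extends D P = ∀ e b → P e ≡ just b → D e ≡ b

  -- P directs exactly the edges incident with z
  IsPreOrientation : Vertex → PartialOrientation → Set
  IsPreOrientation z P = ∀ e → Is-just (P e) ⇔ Incident z e

  ZeroSum : (Vertex → ℤ) → Set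
  ZeroSum β = ℤΣ.sum β ≡₃ 0ℤ

  IsOrientationFor : (Vertex → ℤ) → Orientation → Set
  IsOrientationFor β D = ∀ v → netDegree (total D) v ≡₃ β v

  ℤ₃-Connected : Set
  ℤ₃-Connected = ∀ β → ZeroSum β → ∃[ D ] IsOrientationFor β D

  ℤ₃-ExtendableAt : Vertex → Set
  ℤ₃-ExtendableAt z = ∀ β → ZeroSum β →
    ∀ P → IsPreOrientation z P → netDegree P z ≡₃ β z →
    ∃[ D ] Extends D P × IsOrientationFor β D

open Graph using (order; Vertex; Edge; end₁; end₂)

-- Subgraphs are taken up to relabelling: H together with the inclusions of
-- its vertices and edges, carrying the reference directions of G.
record IsSubgraph (H G : Graph) : Set where
  field
    vertex           : Vertex H → Vertex G
    edge             : Edge H → Edge G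
    vertex-injective : Injective _≡_ _≡_ vertex
    edge-injective   : Injective _≡_ _≡_ edge
    end₁-preserved   : ∀ e → end₁ G (edge e) ≡ vertex (end₁ H e)
    end₂-preserved   : ∀ e → end₂ G (edge e) ≡ vertex (end₂ H e)

Nontrivial : Graph → Set
Nontrivial G = 1 < order G

ℤ₃-Reduced : Graph → Set
ℤ₃-Reduced G = ∀ H → IsSubgraph H G → Nontrivial H → ¬ Graph.ℤ₃-Connected H

{-# OPTIONS --safe #-}
module Submission where

-- (i) Suppose that G is reduced with minimum degree at least 5, and let S be minimal among the
-- vertex sets with at least two elements and at most five edges leaving (V(G) is such a set).
-- Collapse V(G) - S to a vertex z, and add edges between z and S until z has degree 5. By
-- minimality, every cut of the result with fewer than six edges has five and isolates a
-- vertex, so (A) applies at z. Orienting the edges at z arbitrarily and extending shows that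
-- the result without z, which is G[S], is ℤ₃-connected: a contradiction.
--
-- (ii) By induction on the order. A nontrivial 5-edge-connected G has minimum degree at least
-- 5, so by (B) it contains a nontrivial ℤ₃-connected H. The contraction G/H is again
-- 5-edge-connected, and a β-orientation of G/H is completed to one of G by an orientation of H
-- absorbing the defect on V(H). The existence of H is only known up to double negation, which
-- suffices because it is decidable whether a β-orientation exists.

open import Defs
open import Algebra.Bundles using (CommutativeMonoid)
import Algebra.Properties.CommutativeMonoid.Sum
open import Data.Bool.Base using (Bool; true; false; not; _∧_; _∨_; _xor_; if_then_else_)
open import Data.Bool.Properties as Bool using (¬-not; not-involutive)
open import Data.Fin.Base using (Fin; zero; suc; punchOut; splitAt; _↑ʳ_; fromℕ<)
open import Data.Fin.Properties
  using (_≟_; any?; all?; suc-injective; 0≢1+n; punchIn-punchOut; splitAt-↑ʳ; splitAt⁻¹-↑ʳ;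
         injective⇒≤; sequence)
open import Data.Fin.Subset as Subset using (Subset; _∈_; _∉_; _⊂_)
open import Data.Fin.Subset.Induction using (⊂-wellFounded)
open import Data.Fin.Subset.Properties using (_∈?_; anySubset?; x∈∁p⇒x∉p; x∉p⇒x∈∁p; ∈⊤)
open import Data.Integer.Base as ℤ using (ℤ; +_; 0ℤ; 1ℤ; -1ℤ)
open import Data.Integer.Divisibility.Signed using (_∣_; _∣?_; divides; ∣m⇒∣-m; ∣m∣n⇒∣m+n)
import Data.Integer.Properties as ℤ
open import Data.Integer.Tactic.RingSolver using (solve-∀)
open import Data.List.Base using (map; allFin)
open import Data.List.Extrema.Nat using (v≤min⁺; min≤v⁺)
import Data.List.Relation.Unary.All.Properties as All
import Data.List.Relation.Unary.Any.Properties as Any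
open import Data.Maybe.Base using (Maybe; just; nothing; maybe′)
open import Data.Maybe using (Is-just)
open import Data.Maybe.Properties using (≡-dec)
open import Data.Maybe.Relation.Unary.Any using (just)
open import Data.Nat.Base as ℕ using (ℕ; _≤_; _<_; _∸_; z≤n; s≤s)
open import Data.Nat.Induction using (<-wellFounded)
import Data.Nat.Properties as ℕ
open import Data.Product.Base using (∃-syntax; _×_; _,_; proj₁; proj₂)
open import Data.Sum.Base using (_⊎_; inj₁; inj₂; [_,_]′)
open import Data.Unit.Base using (tt)
open import Data.Vec.Base using (lookup; tabulate)
open import Data.Vec.Properties using (lookup∘tabulate; lookup-replicate; []=⇒lookup; lookup⇒[]=)
open import Effect.Monad using (RawMonad)
open import Function.Base using (_∘_; const)
open import Function.Bundles using (mk⇔)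
open import Function.Definitions using (Injective)
open import Induction.WellFounded using (Acc; acc)
open import Level using (0ℓ)
open import Relation.Binary.Construct.Closure.ReflexiveTransitive using (ε; _◅_; _◅◅_)
open import Relation.Binary.PropositionalEquality
  using (_≡_; _≢_; refl; sym; trans; cong; cong₂; subst)
open import Relation.Nullary
  using (¬_; Dec; yes; no; does; ¬?; _×-dec_; contradiction; ¬¬-excluded-middle)
open import Relation.Nullary.Decidable
  using (dec-true; dec-false; decidable-stable; map′)
open import Relation.Nullary.Negation using (¬¬-Monad)
open import Relation.Unary using (Pred; Decidable)
open Graph

-- Finite sums in a commutative monoid

module SumInjection {c ℓ} (M : CommutativeMonoid c ℓ) where
  open CommutativeMonoid M
    renaming (Carrier to C; _∙_ to _+_; ε to 0#; refl to ≈-refl; sym to ≈-sym; trans to ≈-trans)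
  open Algebra.Properties.CommutativeMonoid.Sum M
  open import Relation.Binary.Reasoning.Setoid setoid

  sum-zero : ∀ {n} {f : Fin n → C} → (∀ i → f i ≈ 0#) → sum f ≈ 0#
  sum-zero {n} f≈0 = ≈-trans (sum-cong-≋ f≈0) (sum-replicate-zero n)

  sum-single : ∀ {n} (i : Fin n) x → sum (λ j → if does (i ≟ j) then x else 0#) ≈ x
  sum-single {ℕ.suc n} zero x = ≈-trans (∙-congˡ (sum-replicate-zero n)) (identityʳ x)
  sum-single (suc i) x = ≈-trans (identityˡ _) (sum-single i x)

  -- Each `f i` is the sum of `f ∘ μ` over the fibre of `μ` above `i`: by injectivity the fibre has
  -- at most one point, and `f` vanishes where it is empty. Exchanging the two sums finishes. This
  -- is what discards edges that contribute nothing.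
  sum-injection : ∀ {k n} (μ : Fin k → Fin n) → Injective _≡_ _≡_ μ → (f : Fin n → C) →
    (∀ i → (∀ j → μ j ≢ i) → f i ≈ 0#) → sum f ≈ sum (f ∘ μ)
  sum-injection {k} {n} μ μ-inj f f≈0 = begin
    sum f                                                                   ≈⟨ sum-cong-≋ fiber ⟩
    sum (λ i → sum λ j → if does (μ j ≟ i) then f (μ j) else 0#)
      ≈⟨ ∑-comm (λ i j → if does (μ j ≟ i) then f (μ j) else 0#) ⟩
    sum (λ j → sum λ i → if does (μ j ≟ i) then f (μ j) else 0#)
      ≈⟨ sum-cong-≋ (λ j → sum-single (μ j) (f (μ j))) ⟩
    sum (f ∘ μ)                                                             ∎
    where
    term : ∀ j j′ → (if does (μ j′ ≟ μ j) then f (μ j′) else 0#)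
                  ≡ (if does (j ≟ j′) then f (μ j) else 0#)
    term j j′ with j ≟ j′
    ... | yes refl = cong (if_then f (μ j) else 0#) (dec-true (μ j ≟ μ j) refl)
    ... | no j≢j′  = cong (if_then f (μ j′) else 0#)
                       (dec-false (μ j′ ≟ μ j) (λ eq → j≢j′ (sym (μ-inj eq))))
    fiber : ∀ i → f i ≈ sum (λ j → if does (μ j ≟ i) then f (μ j) else 0#)
    fiber i with any? (λ j → μ j ≟ i)
    ... | yes (j , refl) = ≈-sym (≈-trans (reflexive (sum-cong-≗ (term j))) (sum-single j _))
    ... | no  i∉μ = ≈-trans (f≈0 i (λ j eq → i∉μ (j , eq))) (≈-sym (sum-zero λ j →
      reflexive (cong (if_then f (μ j) else 0#) (dec-false (μ j ≟ i) (λ eq → i∉μ (j , eq))))))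

-- A record, so that both sides can be recovered from the type by unification.
infix 4 _≈₃_
record _≈₃_ (a b : ℤ) : Set where
  constructor mod₃
  field unmod₃ : a ≡₃ b
open _≈₃_

≈₃-reflexive : ∀ {a b} → a ≡ b → a ≈₃ b
≈₃-reflexive {a} refl = mod₃ (divides 0ℤ (ℤ.+-inverseʳ a))

≈₃-refl : ∀ a → a ≈₃ a
≈₃-refl a = ≈₃-reflexive refl

≈₃-sym : ∀ {a b} → a ≈₃ b → b ≈₃ a
≈₃-sym {a} {b} (mod₃ p) = mod₃ (subst (+ 3 ∣_) (lemma a b) (∣m⇒∣-m p))
  where
  lemma : ∀ a b → ℤ.- (a ℤ.- b) ≡ b ℤ.- a
  lemma = solve-∀

≈₃-trans : ∀ {a b c} → a ≈₃ b → b ≈₃ c → a ≈₃ c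
≈₃-trans {a} {b} {c} (mod₃ p) (mod₃ q) = mod₃ (subst (+ 3 ∣_) (lemma a b c) (∣m∣n⇒∣m+n p q))
  where
  lemma : ∀ a b c → (a ℤ.- b) ℤ.+ (b ℤ.- c) ≡ a ℤ.- c
  lemma = solve-∀

≈₃-+-cong : ∀ {a b c d} → a ≈₃ b → c ≈₃ d → a ℤ.+ c ≈₃ b ℤ.+ d
≈₃-+-cong {a} {b} {c} {d} (mod₃ p) (mod₃ q) =
  mod₃ (subst (+ 3 ∣_) (lemma a b c d) (∣m∣n⇒∣m+n p q))
  where
  lemma : ∀ a b c d → (a ℤ.- b) ℤ.+ (c ℤ.- d) ≡ (a ℤ.+ c) ℤ.- (b ℤ.+ d)
  lemma = solve-∀

ℤ₃-commutativeMonoid : CommutativeMonoid 0ℓ 0ℓ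
ℤ₃-commutativeMonoid = record
  { Carrier = ℤ ; _≈_ = _≈₃_ ; _∙_ = ℤ._+_ ; ε = 0ℤ
  ; isCommutativeMonoid = record
    { isMonoid = record
      { isSemigroup = record
        { isMagma = record
          { isEquivalence = record
            { refl = ≈₃-reflexive refl ; sym = ≈₃-sym ; trans = ≈₃-trans }
          ; ∙-cong = ≈₃-+-cong }
        ; assoc = λ a b c → ≈₃-reflexive (ℤ.+-assoc a b c) }
      ; identity = (≈₃-reflexive ∘ ℤ.+-identityˡ) , (≈₃-reflexive ∘ ℤ.+-identityʳ) }
    ; comm = λ a b → ≈₃-reflexive (ℤ.+-comm a b) } }

module ℕΣ where
  open Algebra.Properties.CommutativeMonoid.Sum ℕ.+-0-commutativeMonoid public
  open SumInjection ℕ.+-0-commutativeMonoid public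

module ℤΣ where
  open Algebra.Properties.CommutativeMonoid.Sum ℤ.+-0-commutativeMonoid public
  open SumInjection ℤ.+-0-commutativeMonoid public

-- The sums are the same integers as in `ℤΣ`; only the equality is coarser, as needed for functions
-- that vanish only modulo 3.
module ℤ₃Σ where
  open Algebra.Properties.CommutativeMonoid.Sum ℤ₃-commutativeMonoid public
  open SumInjection ℤ₃-commutativeMonoid public

sum-mono-≤ : ∀ {n} {f g : Fin n → ℕ} → (∀ i → f i ≤ g i) → ℕΣ.sum f ≤ ℕΣ.sum g
sum-mono-≤ {ℕ.zero}  f≤g = z≤n
sum-mono-≤ {ℕ.suc n} f≤g = ℕ.+-mono-≤ (f≤g zero) (sum-mono-≤ (f≤g ∘ suc))

sum-ones : ∀ n → ℕΣ.sum {n} (const 1) ≡ n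
sum-ones ℕ.zero    = refl
sum-ones (ℕ.suc n) = cong ℕ.suc (sum-ones n)

sum-splitAt : ∀ k {n} (f : Fin k ⊎ Fin n → ℕ) →
  ℕΣ.sum (f ∘ splitAt k) ≡ ℕΣ.sum (f ∘ inj₁) ℕ.+ ℕΣ.sum (f ∘ inj₂)
sum-splitAt ℕ.zero    f = refl
sum-splitAt (ℕ.suc k) f = trans
  (cong (f (inj₁ zero) ℕ.+_)
    (trans (ℕΣ.sum-cong-≗ shift) (sum-splitAt k (f ∘ [ inj₁ ∘ suc , inj₂ ]′))))
  (sym (ℕ.+-assoc (f (inj₁ zero)) _ _))
  where
  shift : ∀ i → f (splitAt (ℕ.suc k) (suc i)) ≡ f ([ inj₁ ∘ suc , inj₂ ]′ (splitAt k i))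
  shift i with splitAt k i
  ... | inj₁ _ = refl
  ... | inj₂ _ = refl

sum-minus : ∀ {n} (f g : Fin n → ℤ) → ℤΣ.sum (λ i → f i ℤ.- g i) ≡ ℤΣ.sum f ℤ.- ℤΣ.sum g
sum-minus {ℕ.zero}  f g = refl
sum-minus {ℕ.suc n} f g =
  trans (cong (ℤ._+_ (f zero ℤ.- g zero)) (sum-minus (f ∘ suc) (g ∘ suc)))
        (lemma (f zero) (g zero) _ _)
  where
  lemma : ∀ a b c d → (a ℤ.- b) ℤ.+ (c ℤ.- d) ≡ (a ℤ.+ c) ℤ.- (b ℤ.+ d)
  lemma = solve-∀

sum-+ : ∀ {n} (f : Fin n → ℕ) → + ℕΣ.sum f ≡ ℤΣ.sum (+_ ∘ f)
sum-+ {ℕ.zero}  f = refl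
sum-+ {ℕ.suc n} f = cong (ℤ._+_ (+ f zero)) (sum-+ (f ∘ suc))

-- Enumerating decidable sets and extending functions along injections

record Enumeration {n} (P : Pred (Fin n) 0ℓ) : Set where
  field
    cardinality     : ℕ
    index           : Fin cardinality → Fin n
    index-injective : Injective _≡_ _≡_ index
    satisfied       : ∀ j → P (index j)
    position        : ∀ {i} → P i → ∃[ j ] index j ≡ i

abstract
  enumerate : ∀ {n} {P : Pred (Fin n) 0ℓ} → Decidable P → Enumeration P
  enumerate {ℕ.zero} P? = record
    { cardinality = 0 ; index = λ () ; index-injective = λ {} ; satisfied = λ ()
    ; position = λ {} }
  enumerate {ℕ.suc n} {P} P? with enumerate (P? ∘ suc) | P? zero
  ... | E | no ¬p = record
    { cardinality = E.cardinality ; index = suc ∘ E.index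
    ; index-injective = E.index-injective ∘ suc-injective
    ; satisfied = E.satisfied
    ; position = λ { {zero} p → contradiction p ¬p
                   ; {suc i} p → proj₁ (E.position p) , cong suc (proj₂ (E.position p)) } }
    where module E = Enumeration E
  ... | E | yes p₀ = record
    { cardinality = ℕ.suc E.cardinality
    ; index = λ { zero → zero ; (suc j) → suc (E.index j) }
    ; index-injective = λ { {zero} {zero} _ → refl
                          ; {suc i} {suc j} eq → cong suc (E.index-injective (suc-injective eq)) }
    ; satisfied = λ { zero → p₀ ; (suc j) → E.satisfied j }
    ; position = λ { {zero} p → zero , refl
                   ; {suc i} p → suc (proj₁ (E.position p)) , cong suc (proj₂ (E.position p)) } }
    where module E = Enumeration E

  override : ∀ {k n} {A : Set} → (Fin k → Fin n) → (Fin k → A) → (Fin n → A) → Fin n → A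
  override μ f g i with any? (λ j → μ j ≟ i)
  ... | yes (j , _) = f j
  ... | no _        = g i

  override-∈ : ∀ {k n} {A : Set} (μ : Fin k → Fin n) → Injective _≡_ _≡_ μ →
    (f : Fin k → A) (g : Fin n → A) → ∀ j → override μ f g (μ j) ≡ f j
  override-∈ μ μ-inj f g j with any? (λ j′ → μ j′ ≟ μ j)
  ... | yes (j′ , eq) = cong f (μ-inj eq)
  ... | no  j∉μ       = contradiction (j , refl) j∉μ

  override-∉ : ∀ {k n} {A : Set} (μ : Fin k → Fin n) (f : Fin k → A) (g : Fin n → A) →
    ∀ {i} → (∀ j → μ j ≢ i) → override μ f g i ≡ g i
  override-∉ μ f g {i} i∉μ with any? (λ j → μ j ≟ i)
  ... | yes (j , eq) = contradiction eq (i∉μ j)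
  ... | no _         = refl

-- Boundaries of integer-valued functions on the edges

-- The contribution of an edge carrying `x` to the net outflow at a vertex, where `s` and `t` tell
-- whether the vertex is its first or its second end. With Booleans in place of vertices, identities
-- about one edge become finite case checks.
flowᵇ : Bool → Bool → ℤ → ℤ
flowᵇ s t x = (if s then x else 0ℤ) ℤ.- (if t then x else 0ℤ)

flow : ∀ {n} → Fin n → Fin n → ℤ → Fin n → ℤ
flow a b x v = flowᵇ (does (a ≟ v)) (does (b ≟ v)) x

flowᵇ-loop : ∀ s x → flowᵇ s s x ≡ 0ℤ
flowᵇ-loop s x = ℤ.+-inverseʳ (if s then x else 0ℤ)

flowᵇ-zero : ∀ s t → flowᵇ s t 0ℤ ≡ 0ℤ
flowᵇ-zero true  true  = refl
flowᵇ-zero true  false = refl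
flowᵇ-zero false true  = refl
flowᵇ-zero false false = refl

flowᵇ-+ : ∀ s t x y → flowᵇ s t (x ℤ.+ y) ≡ flowᵇ s t x ℤ.+ flowᵇ s t y
flowᵇ-+ s t x y = trans (cong₂ ℤ._-_ (if-+ s) (if-+ t))
  (lemma (x when s) (y when s) (x when t) (y when t))
  where
  _when_ : ℤ → Bool → ℤ
  z when s = if s then z else 0ℤ
  if-+ : ∀ s → (x ℤ.+ y) when s ≡ x when s ℤ.+ y when s
  if-+ true  = refl
  if-+ false = refl
  lemma : ∀ a b c d → (a ℤ.+ b) ℤ.- (c ℤ.+ d) ≡ (a ℤ.- c) ℤ.+ (b ℤ.- d)
  lemma = solve-∀

flow-off : ∀ {n} {a b v : Fin n} x → a ≢ v → b ≢ v → flow a b x v ≡ 0ℤ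
flow-off {a = a} {b} {v} x a≢v b≢v =
  cong₂ (λ s t → flowᵇ s t x) (dec-false (a ≟ v) a≢v) (dec-false (b ≟ v) b≢v)

does-cong : ∀ {A B : Set} (a? : Dec A) (b? : Dec B) → (A → B) → (B → A) → does a? ≡ does b?
does-cong (yes a) b? f g = sym (dec-true b? (f a))
does-cong (no ¬a) b? f g = sym (dec-false b? (¬a ∘ g))

flow-cong : ∀ {m n} {a b v : Fin m} {a′ b′ v′ : Fin n} x →
  (a ≡ v → a′ ≡ v′) → (a′ ≡ v′ → a ≡ v) → (b ≡ v → b′ ≡ v′) → (b′ ≡ v′ → b ≡ v) →
  flow a b x v ≡ flow a′ b′ x v′
flow-cong {a = a} {b} {v} {a′} {b′} {v′} x f f⁻ g g⁻ = cong₂ (λ s t → flowᵇ s t x)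
  (does-cong (a ≟ v) (a′ ≟ v′) f f⁻) (does-cong (b ≟ v) (b′ ≟ v′) g g⁻)

-- The boundary of a 1-chain. The maps `p` and `q` need not come from a `Graph`: loops are allowed
-- and contribute 0, so a collapse of vertices is composed with `p` and `q` directly.
∂ : ∀ {m n} → (p q : Fin m → Fin n) → (Fin m → ℤ) → Fin n → ℤ
∂ p q x v = ℤΣ.sum λ e → flow (p e) (q e) (x e) v

∂-+ : ∀ {m n} (p q : Fin m → Fin n) x y v → ∂ p q (λ e → x e ℤ.+ y e) v ≡ ∂ p q x v ℤ.+ ∂ p q y v
∂-+ p q x y v = trans
  (ℤΣ.sum-cong-≗ λ e → flowᵇ-+ (does (p e ≟ v)) (does (q e ≟ v)) (x e) (y e))
  (ℤΣ.∑-distrib-+ (λ e → flow (p e) (q e) (x e) v) (λ e → flow (p e) (q e) (y e) v))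

-- Over all vertices, an edge gives `x e` at one end and its negative at the other. Hence adding or
-- subtracting a boundary keeps a function zero-sum.
∂-total : ∀ {m n} (p q : Fin m → Fin n) x → ℤΣ.sum (∂ p q x) ≡ 0ℤ
∂-total p q x = trans (ℤΣ.∑-comm (λ v e → flow (p e) (q e) (x e) v)) (ℤΣ.sum-zero λ e →
  trans (sum-minus (λ v → if does (p e ≟ v) then x e else 0ℤ) _)
        (trans (cong₂ ℤ._-_ (ℤΣ.sum-single (p e) (x e)) (ℤΣ.sum-single (q e) (x e)))
               (ℤ.+-inverseʳ (x e))))

sign : Bool → ℤ
sign b = if b then 1ℤ else -1ℤ

value : Maybe Bool → ℤ
value = maybe′ sign 0ℤ

-- Replaces counting by the boundary, which is linear in the edge values, so that orientations can
-- be added, subtracted and restricted. Undirected edges carry 0.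
netDegree-∂ : ∀ G P v → netDegree G P v ≡ ∂ (end₁ G) (end₂ G) (value ∘ P) v
netDegree-∂ G P v = trans (cong₂ ℤ._-_ (sum-+ {size G} _) (sum-+ {size G} _))
  (trans (sym (sum-minus {size G} _ _)) (ℤΣ.sum-cong-≗ pointwise))
  where
  indicator : Bool → ℤ
  indicator b = + (if b then 1 else 0)
  signed : ∀ b s t → indicator (if b then s else t) ℤ.- indicator (if b then t else s)
    ≡ flowᵇ s t (sign b)
  signed true  true  true  = refl
  signed true  true  false = refl
  signed true  false true  = refl
  signed true  false false = refl
  signed false true  true  = refl
  signed false true  false = refl
  signed false false true  = refl
  signed false false false = refl
  pointwise : ∀ e → + (if does (≡-dec _≟_ (tail G P e) (just v)) then 1 else 0)
            ℤ.- + (if does (≡-dec _≟_ (head G P e) (just v)) then 1 else 0)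
            ≡ flow (end₁ G e) (end₂ G e) (value (P e)) v
  pointwise e with P e
  ... | nothing    = sym (flowᵇ-zero (does (end₁ G e ≟ v)) (does (end₂ G e ≟ v)))
  ... | just true  = signed true (does (end₁ G e ≟ v)) (does (end₂ G e ≟ v))
  ... | just false = signed false (does (end₁ G e ≟ v)) (does (end₂ G e ≟ v))

-- Cuts

𝟙 : Bool → ℕ
𝟙 b = if b then 1 else 0

-- A cut is given by a Boolean colouring of the vertices, and loops never cross it. Pulling a cut
-- back along a collapse is then composition of the colouring with the collapse.
cut : ∀ {m n} → (p q : Fin m → Fin n) → (Fin n → Bool) → ℕ
cut p q b = ℕΣ.sum λ e → 𝟙 (b (p e) xor b (q e))

cut-cong : ∀ {m n} (p q : Fin m → Fin n) {b c} → (∀ v → b v ≡ c v) → cut p q b ≡ cut p q c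
cut-cong p q b≗c = ℕΣ.sum-cong-≗ λ e → cong₂ (λ s t → 𝟙 (s xor t)) (b≗c (p e)) (b≗c (q e))

cut-not : ∀ {m n} (p q : Fin m → Fin n) b → cut p q (not ∘ b) ≡ cut p q b
cut-not p q b = ℕΣ.sum-cong-≗ λ e → cong 𝟙 (xor-not (b (p e)) (b (q e)))
  where
  xor-not : ∀ s t → not s xor not t ≡ s xor t
  xor-not true  t = refl
  xor-not false t = not-involutive t

does-∈? : ∀ {n} (S : Subset n) v → does (v ∈? S) ≡ lookup S v
does-∈? S v with lookup S v in eq
... | true  = dec-true (v ∈? S) (lookup⇒[]= v S eq)
... | false = dec-false (v ∈? S) (λ v∈S → contradiction (trans (sym ([]=⇒lookup v∈S)) eq) λ ())

cutSize-cut : ∀ G S → cutSize G S ≡ cut (end₁ G) (end₂ G) (lookup S)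
cutSize-cut G S = ℕΣ.sum-cong-≗ λ e → cong 𝟙
  (trans (∨∧-xor (does (end₁ G e ∈? S)) (does (end₂ G e ∈? S)))
         (cong₂ _xor_ (does-∈? S (end₁ G e)) (does-∈? S (end₂ G e))))
  where
  ∨∧-xor : ∀ s t → (s ∧ not t) ∨ (not s ∧ t) ≡ s xor t
  ∨∧-xor true  true  = refl
  ∨∧-xor true  false = refl
  ∨∧-xor false t     = refl

-- Without loops no edge has both ends at `v`, so disjunction and exclusive disjunction agree.
degree-cut : ∀ G v → degree G v ≡ cut (end₁ G) (end₂ G) (λ w → does (w ≟ v))
degree-cut G v = ℕΣ.sum-cong-≗ λ e → cong 𝟙 (∨-xor e)
  where
  ∨-xor : ∀ e → does (end₁ G e ≟ v) ∨ does (end₂ G e ≟ v)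
              ≡ does (end₁ G e ≟ v) xor does (end₂ G e ≟ v)
  ∨-xor e with end₁ G e ≟ v | end₂ G e ≟ v
  ... | yes p | yes q = contradiction (trans p (sym q)) (loopless G e)
  ... | yes _ | no _  = refl
  ... | no _  | _     = refl

CutBound : ∀ {m n} → (p q : Fin m → Fin n) → ℕ → Set
CutBound p q k = ∀ b → ∃[ u ] b u ≡ true → ∃[ v ] b v ≡ false → k ≤ cut p q b

cutSize-tabulate : ∀ G b → cutSize G (tabulate b) ≡ cut (end₁ G) (end₂ G) b
cutSize-tabulate G b = trans (cutSize-cut G (tabulate b))
  (cut-cong (end₁ G) (end₂ G) (lookup∘tabulate b))

∈-tabulate : ∀ {n} (b : Fin n → Bool) {v} → b v ≡ true → v ∈ tabulate b
∈-tabulate b {v} bv = lookup⇒[]= v (tabulate b) (trans (lookup∘tabulate b v) bv)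

tabulate-∈ : ∀ {n} (b : Fin n → Bool) {v} → v ∈ tabulate b → b v ≡ true
tabulate-∈ b {v} v∈ = trans (sym (lookup∘tabulate b v)) ([]=⇒lookup v∈)

∉-lookup : ∀ {n} {S : Subset n} {v} → v ∉ S → lookup S v ≡ false
∉-lookup {S = S} {v} v∉S = trans (sym (does-∈? S v)) (dec-false (v ∈? S) v∉S)

edgeConnected⇒cutBound : ∀ G {k} → EdgeConnected G k → CutBound (end₁ G) (end₂ G) k
edgeConnected⇒cutBound G ec b (u , bu) (v , bv) = subst (_ ≤_) (cutSize-tabulate G b)
  (ec (tabulate b) ((u , ∈-tabulate b bu) , (v , x∉p⇒x∈∁p λ v∈ →
    contradiction (trans (sym (tabulate-∈ b v∈)) bv) λ ())))

cutBound⇒edgeConnected : ∀ G {k} → CutBound (end₁ G) (end₂ G) k → EdgeConnected G k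
cutBound⇒edgeConnected G cb S ((u , u∈S) , (v , v∈∁S)) = subst (_ ≤_) (sym (cutSize-cut G S))
  (cb (lookup S) (u , []=⇒lookup u∈S) (v , ∉-lookup (x∈∁p⇒x∉p v∈∁S)))

crosses⇒≢ : ∀ G S e → Crosses G S e → lookup S (end₁ G e) ≢ lookup S (end₂ G e)
crosses⇒≢ G S e (inj₁ (p∈S , q∉S)) eq = q∉S (lookup⇒[]= _ S (trans (sym eq) ([]=⇒lookup p∈S)))
crosses⇒≢ G S e (inj₂ (p∉S , q∈S)) eq = p∉S (lookup⇒[]= _ S (trans eq ([]=⇒lookup q∈S)))

¬crosses⇒≡ : ∀ G S e → ¬ Crosses G S e → lookup S (end₁ G e) ≡ lookup S (end₂ G e)
¬crosses⇒≡ G S e ¬X with end₁ G e ∈? S | end₂ G e ∈? S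
... | yes p∈S | yes q∈S = trans ([]=⇒lookup p∈S) (sym ([]=⇒lookup q∈S))
... | yes p∈S | no q∉S  = contradiction (inj₁ (p∈S , q∉S)) ¬X
... | no p∉S  | yes q∈S = contradiction (inj₂ (p∉S , q∈S)) ¬X
... | no p∉S  | no q∉S  = trans (∉-lookup p∉S) (sym (∉-lookup q∉S))

-- One side of the cut is the singleton of `w`, whichever colour that side has.
IsolatesVertex : ∀ {n} → (Fin n → Bool) → Set
IsolatesVertex b = ∃[ w ] ∀ v → v ≢ w → b v ≢ b w

isolatesVertex-not : ∀ {n} {b : Fin n → Bool} → IsolatesVertex (not ∘ b) → IsolatesVertex b
isolatesVertex-not (w , far) = w , λ v v≢w eq → far v v≢w (cong not eq)

≢-≢⇒≡ : ∀ {a b c : Bool} → a ≢ c → b ≢ c → a ≡ b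
≢-≢⇒≡ a≢c b≢c = trans (¬-not a≢c) (sym (¬-not b≢c))

-- If one side of the cut is {w}, then two nontrivial components C and C′ lie on the other
-- side. The cut around C and the cut around the vertices outside C ∪ {w} are edge-disjoint
-- parts of the given cut, since every edge of either joins w to the other side.
-- Reachability is decided only under a double negation.
essential-isolating-cut : ∀ G {k} → CutBound (end₁ G) (end₂ G) k →
  ∀ S → IsolatesVertex (lookup S) → Essential G (Crosses G S) → k ℕ.+ k ≤ cutSize G S
essential-isolating-cut G {k} bound S (w , far) (u , v , nu , nv , u≁v) =
  -- The bound is decidable, so it may be proved under a double negation; since there are finitely
  -- many vertices, `sequence` merges the separate double negations into one.
  decidable-stable (k ℕ.+ k ℕ.≤? cutSize G S) λ ¬bound →
    sequence (RawMonad.rawApplicative ¬¬-Monad) (λ x → ¬¬-excluded-middle)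
      (λ reachable? → ¬bound (main reachable?))
  where
  b : Vertex G → Bool
  b = lookup S
  p q : Edge G → Vertex G
  p = end₁ G
  q = end₂ G
  _∼_ : Vertex G → Vertex G → Set
  _∼_ = SameComponent G (Crosses G S)

  ∼⇒≡ : ∀ {x y} → x ∼ y → b x ≡ b y
  ∼⇒≡ ε = refl
  ∼⇒≡ ((e , ¬X , inj₁ (refl , refl)) ◅ r) = trans (¬crosses⇒≡ G S e ¬X) (∼⇒≡ r)
  ∼⇒≡ ((e , ¬X , inj₂ (refl , refl)) ◅ r) = trans (sym (¬crosses⇒≡ G S e ¬X)) (∼⇒≡ r)

  nontrivial⇒≢w : ∀ {x} → NontrivialComponent G (Crosses G S) x → x ≢ w
  nontrivial⇒≢w (y , y≢x , x∼y) refl = far y y≢x (sym (∼⇒≡ x∼y))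

  u≢w : u ≢ w
  u≢w = nontrivial⇒≢w nu
  v≢w : v ≢ w
  v≢w = nontrivial⇒≢w nv

  w-isolated : ∀ {x} → x ∼ w → x ≡ w
  w-isolated {x} x∼w with x ≟ w
  ... | yes x≡w = x≡w
  ... | no x≢w  = contradiction (∼⇒≡ x∼w) (far x x≢w)

  main : (∀ x → Dec (u ∼ x)) → k ℕ.+ k ≤ cutSize G S
  main reachable? = begin
    k ℕ.+ k                   ≤⟨ ℕ.+-mono-≤
      (bound C (u , dec-true (reachable? u) ε) (v , v∉C))
      (bound D (v , cong₂ (λ s t → not s ∧ not t) v∉C (dec-false (v ≟ w) v≢w))
               (u , cong (λ s → not s ∧ not (does (u ≟ w))) (dec-true (reachable? u) ε))) ⟩
    cut p q C ℕ.+ cut p q D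
      ≡⟨ ℕΣ.∑-distrib-+ (λ e → 𝟙 (C (p e) xor C (q e))) (λ e → 𝟙 (D (p e) xor D (q e))) ⟨
    ℕΣ.sum (λ e → 𝟙 (C (p e) xor C (q e)) ℕ.+ 𝟙 (D (p e) xor D (q e))) ≤⟨ sum-mono-≤ pointwise ⟩
    cut p q b                 ≡⟨ cutSize-cut G S ⟨
    cutSize G S               ∎
    where
    open ℕ.≤-Reasoning
    C D : Vertex G → Bool
    C x = does (reachable? x)
    D x = not (C x) ∧ not (does (x ≟ w))

    v∉C : C v ≡ false
    v∉C = dec-false (reachable? v) u≁v
    w∉C : C w ≡ false
    w∉C = dec-false (reachable? w) (λ u∼w → u≢w (w-isolated u∼w))
    w∉D : D w ≡ false
    w∉D = trans (cong (λ t → not (C w) ∧ not t) (dec-true (w ≟ w) refl)) (Bool.∧-zeroʳ _)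
    D-off : ∀ {x} → x ≢ w → D x ≡ not (C x)
    D-off {x} x≢w = trans (cong (λ t → not (C x) ∧ not t) (dec-false (x ≟ w) x≢w)) (Bool.∧-identityʳ _)

    C-adjacent : ∀ e → b (p e) ≡ b (q e) → C (p e) ≡ C (q e)
    C-adjacent e eq = does-cong (reachable? _) (reachable? _)
      (λ u∼p → u∼p ◅◅ ((e , ¬X , inj₁ (refl , refl)) ◅ ε))
      (λ u∼q → u∼q ◅◅ ((e , ¬X , inj₂ (refl , refl)) ◅ ε))
      where ¬X = λ X → crosses⇒≢ G S e X eq

    xor-≢ : ∀ {s t} → s ≢ t → s xor t ≡ true
    xor-≢ {true}  {true}  s≢t = contradiction refl s≢t
    xor-≢ {true}  {false} s≢t = refl
    xor-≢ {false} {true}  s≢t = refl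
    xor-≢ {false} {false} s≢t = contradiction refl s≢t

    -- An edge at `w`: its other end lies in exactly one of `C` and `D`, and `w` in neither, so
    -- exactly one of the two smaller cuts contains the edge, as does the given cut.
    oneʳ : ∀ {c₁ c₂ d₁ d₂ s t} → c₁ ≡ false → d₁ ≡ false → d₂ ≡ not c₂ → s ≢ t →
      𝟙 (c₁ xor c₂) ℕ.+ 𝟙 (d₁ xor d₂) ≤ 𝟙 (s xor t)
    oneʳ {c₂ = true}  refl refl refl s≢t = ℕ.≤-reflexive (cong 𝟙 (sym (xor-≢ s≢t)))
    oneʳ {c₂ = false} refl refl refl s≢t = ℕ.≤-reflexive (cong 𝟙 (sym (xor-≢ s≢t)))
    oneˡ : ∀ {c₁ c₂ d₁ d₂ s t} → c₂ ≡ false → d₂ ≡ false → d₁ ≡ not c₁ → s ≢ t →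
      𝟙 (c₁ xor c₂) ℕ.+ 𝟙 (d₁ xor d₂) ≤ 𝟙 (s xor t)
    oneˡ {c₁ = true}  refl refl refl s≢t = ℕ.≤-reflexive (cong 𝟙 (sym (xor-≢ s≢t)))
    oneˡ {c₁ = false} refl refl refl s≢t = ℕ.≤-reflexive (cong 𝟙 (sym (xor-≢ s≢t)))
    -- An edge avoiding `w`: its ends are on the same side of the given cut, hence both in `C` or
    -- both in `D`.
    none : ∀ {c₁ c₂ d₁ d₂ s t} → d₁ ≡ not c₁ → d₂ ≡ not c₂ → c₁ ≡ c₂ →
      𝟙 (c₁ xor c₂) ℕ.+ 𝟙 (d₁ xor d₂) ≤ 𝟙 (s xor t)
    none {c₁ = true}  refl refl refl = z≤n
    none {c₁ = false} refl refl refl = z≤n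

    pointwise : ∀ e → 𝟙 (C (p e) xor C (q e)) ℕ.+ 𝟙 (D (p e) xor D (q e)) ≤ 𝟙 (b (p e) xor b (q e))
    pointwise e = cases (p e ≟ w) (q e ≟ w)
      where
      cases : Dec (p e ≡ w) → Dec (q e ≡ w) →
        𝟙 (C (p e) xor C (q e)) ℕ.+ 𝟙 (D (p e) xor D (q e)) ≤ 𝟙 (b (p e) xor b (q e))
      cases (yes pw) (yes qw) = contradiction (trans pw (sym qw)) (loopless G e)
      cases (yes pw) (no q≢w) = oneʳ (trans (cong C pw) w∉C) (trans (cong D pw) w∉D) (D-off q≢w)
        λ eq → far (q e) q≢w (trans (sym eq) (cong b pw))
      cases (no p≢w) (yes qw) = oneˡ (trans (cong C qw) w∉C) (trans (cong D qw) w∉D) (D-off p≢w)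
        λ eq → far (p e) p≢w (trans eq (cong b qw))
      cases (no p≢w) (no q≢w) = none {s = b (p e)} {b (q e)} (D-off p≢w) (D-off q≢w)
        (C-adjacent e (≢-≢⇒≡ (far (p e) p≢w) (far (q e) q≢w)))

-- Collapsing the complement of a set of vertices to the single vertex zero

module Collapse {n} {P : Pred (Fin n) 0ℓ} (P? : Decidable P) where
  open Enumeration (enumerate P?) public

  collapse : Fin n → Fin (ℕ.suc cardinality)
  collapse v with P? v
  ... | yes pv = suc (proj₁ (position pv))
  ... | no _   = zero

  collapse-∉ : ∀ {v} → ¬ P v → collapse v ≡ zero
  collapse-∉ {v} ¬pv with P? v
  ... | yes pv = contradiction pv ¬pv
  ... | no _   = refl

  collapse-suc : ∀ {v j} → collapse v ≡ suc j → index j ≡ v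
  collapse-suc {v} eq with P? v
  collapse-suc refl | yes pv = proj₂ (position pv)

  collapse-index : ∀ j → collapse (index j) ≡ suc j
  collapse-index j with P? (index j)
  ... | yes pv = cong suc (index-injective (proj₂ (position pv)))
  ... | no ¬pv = contradiction (satisfied j) ¬pv

  -- The vertex `suc i` has `index i` as its only preimage, so incidences there are unchanged.
  ∂-collapse : ∀ {m} (p q : Fin m → Fin n) x i →
    ∂ (collapse ∘ p) (collapse ∘ q) x (suc i) ≡ ∂ p q x (index i)
  ∂-collapse p q x i = ℤΣ.sum-cong-≗ λ e →
    flow-cong (x e) (to (p e)) (from (p e)) (to (q e)) (from (q e))
    where
    to : ∀ v → collapse v ≡ suc i → v ≡ index i
    to v eq = sym (collapse-suc eq)
    from : ∀ v → v ≡ index i → collapse v ≡ suc i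
    from v refl = collapse-index i

graph : ∀ {m n} (p q : Fin m → Fin (ℕ.suc n)) → (∀ e → p e ≢ q e) → Graph
graph {m} {n} p q p≢q = record
  { order = ℕ.suc n ; size = m ; nonempty = s≤s z≤n ; end₁ = p ; end₂ = q ; loopless = p≢q }

-- Collapsing creates loops, which `Graph` forbids. Loops cross no cut and have zero boundary, so
-- dropping them preserves both.
module Strip {m n} (p q : Fin m → Fin (ℕ.suc n)) where
  open Enumeration (enumerate (λ e → ¬? (p e ≟ q e))) public

  strip : Graph
  strip = graph (p ∘ index) (q ∘ index) satisfied

  loop : ∀ e → (∀ j → index j ≢ e) → p e ≡ q e
  loop e e∉ = decidable-stable (p e ≟ q e) λ p≢q →
    e∉ (proj₁ (position p≢q)) (proj₂ (position p≢q))

  cut-strip : ∀ b → cut (p ∘ index) (q ∘ index) b ≡ cut p q b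
  cut-strip b = sym (ℕΣ.sum-injection index index-injective _ λ e e∉ →
    cong 𝟙 (trans (cong (λ v → b (p e) xor b v) (sym (loop e e∉))) (Bool.xor-same (b (p e)))))

  ∂-strip : ∀ x v → ∂ (p ∘ index) (q ∘ index) (x ∘ index) v ≡ ∂ p q x v
  ∂-strip x v = sym (ℤΣ.sum-injection index index-injective _ λ e e∉ →
    trans (cong (λ u → flow (p e) u (x e) v) (sym (loop e e∉)))
          (flowᵇ-loop (does (p e ≟ v)) (x e)))

-- Deleting the vertex zero

module Delete {m n} (p q : Fin m → Fin (ℕ.suc n)) (p≢q : ∀ e → p e ≢ q e) (0<n : 0 < n) where
  G : Graph
  G = graph p q p≢q

  open Enumeration (enumerate (λ e → ¬? (incident? G zero e))) public

  p′ q′ : Fin cardinality → Fin n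
  p′ j = punchOut {i = zero} {p (index j)} (λ eq → satisfied j (inj₁ (sym eq)))
  q′ j = punchOut {i = zero} {q (index j)} (λ eq → satisfied j (inj₂ (sym eq)))

  suc-p′ : ∀ j → suc (p′ j) ≡ p (index j)
  suc-p′ j = punchIn-punchOut {i = zero} _
  suc-q′ : ∀ j → suc (q′ j) ≡ q (index j)
  suc-q′ j = punchIn-punchOut {i = zero} _

  delete : Graph
  delete = record
    { order = n ; size = cardinality ; nonempty = 0<n ; end₁ = p′ ; end₂ = q′
    ; loopless = λ j eq → p≢q (index j) (trans (sym (suc-p′ j)) (trans (cong suc eq) (suc-q′ j))) }

  -- Fix a pre-orientation `P` at `zero` and add its boundary to `β`; at `zero` exactly the boundary
  -- of `P` is prescribed, so `P` is admissible. Subtracting `P` from the extension leaves values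
  -- supported on the remaining edges, with boundary `β` modulo 3.
  extendable⇒delete-connected : ℤ₃-ExtendableAt G zero → ℤ₃-Connected delete
  extendable⇒delete-connected extendable β β-zeroSum = D ∘ index , D-orients
    where
    P : PartialOrientation G
    -- The choice is arbitrary: edges at `zero` keep their reference direction.
    P e = if does (incident? G zero e) then just true else nothing

    P-incident : ∀ {e} → Incident G zero e → P e ≡ just true
    P-incident {e} i = cong (if_then just true else nothing) (dec-true (incident? G zero e) i)
    P-¬incident : ∀ {e} → ¬ Incident G zero e → P e ≡ nothing
    P-¬incident {e} ¬i = cong (if_then just true else nothing) (dec-false (incident? G zero e) ¬i)

    P-pre : IsPreOrientation G zero P
    P-pre e = mk⇔ directed⇒incident (λ i → subst Is-just (sym (P-incident i)) (just tt))
      where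
      directed⇒incident : Is-just (P e) → Incident G zero e
      directed⇒incident d = decidable-stable (incident? G zero e) λ ¬i →
        ¬just (subst Is-just (P-¬incident ¬i) d)
        where
        ¬just : ¬ Is-just {A = Bool} nothing
        ¬just ()

    x : Fin m → ℤ
    x = value ∘ P

    βᴳ : Fin (ℕ.suc n) → ℤ
    βᴳ zero    = ∂ p q x zero
    βᴳ (suc i) = β i ℤ.+ ∂ p q x (suc i)

    βᴳ-zeroSum : ZeroSum G βᴳ
    βᴳ-zeroSum = unmod₃ (≈₃-trans (≈₃-reflexive (trans
      (cong (ℤ._+_ (∂ p q x zero)) (ℤΣ.∑-distrib-+ β (∂ p q x ∘ suc)))
      (trans (rearrange (∂ p q x zero) (ℤΣ.sum β) (ℤΣ.sum (∂ p q x ∘ suc)))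
        (trans (cong (ℤ._+_ (ℤΣ.sum β)) (∂-total p q x)) (ℤ.+-identityʳ (ℤΣ.sum β))))))
      (mod₃ {b = 0ℤ} β-zeroSum))
      where
      rearrange : ∀ a b c → a ℤ.+ (b ℤ.+ c) ≡ b ℤ.+ (a ℤ.+ c)
      rearrange = solve-∀

    extension : ∃[ D ] Extends G D P × IsOrientationFor G βᴳ D
    extension = extendable βᴳ βᴳ-zeroSum P P-pre
      (unmod₃ (≈₃-reflexive (netDegree-∂ G P zero)))

    D : Orientation G
    D = proj₁ extension

    y : Fin m → ℤ
    y e = sign (D e) ℤ.- x e

    y-incident : ∀ e → Incident G zero e → y e ≡ 0ℤ
    y-incident e i = cong₂ (λ b z → sign b ℤ.- value z)
      (proj₁ (proj₂ extension) e true (P-incident i)) (P-incident i)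

    y-index : ∀ j → y (index j) ≡ sign (D (index j))
    y-index j = trans (cong (λ z → sign (D (index j)) ℤ.- value z) (P-¬incident (satisfied j)))
      (ℤ.+-identityʳ (sign (D (index j))))

    ∂-delete : ∀ i → ∂ p′ q′ (sign ∘ D ∘ index) i ≡ ∂ p q y (suc i)
    ∂-delete i = sym (trans
      (ℤΣ.sum-injection index index-injective _ λ e e∉ → trans
        (cong (λ z → flow (p e) (q e) z (suc i)) (y-incident e (incident e e∉)))
        (flowᵇ-zero (does (p e ≟ suc i)) (does (q e ≟ suc i))))
      (ℤΣ.sum-cong-≗ λ j → trans
        (cong (λ z → flow (p (index j)) (q (index j)) z (suc i)) (y-index j))
        (cong₂ (λ a b → flow a b (sign (D (index j))) (suc i)) (sym (suc-p′ j)) (sym (suc-q′ j)))))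
      where
      incident : ∀ e → (∀ j → index j ≢ e) → Incident G zero e
      incident e e∉ = decidable-stable (incident? G zero e) λ ¬i →
        e∉ (proj₁ (position ¬i)) (proj₂ (position ¬i))

    D-orients : IsOrientationFor delete β (D ∘ index)
    D-orients i = unmod₃ (≈₃-trans (≈₃-reflexive (trans
      (netDegree-∂ delete (total delete (D ∘ index)) i)
      (trans (∂-delete i) (trans (sym (cancelˡ (∂ p q x (suc i)) (∂ p q y (suc i))))
        (cong (ℤ._- ∂ p q x (suc i)) (trans (sym (∂-+ p q x y (suc i)))
          (ℤΣ.sum-cong-≗ λ e → cong (λ z → flow (p e) (q e) z (suc i)) (x+y (sign (D e)) (x e)))))))))
      (≈₃-trans (≈₃-+-cong
        (≈₃-trans (≈₃-reflexive (sym (netDegree-∂ G (total G D) (suc i))))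
          (mod₃ (proj₂ (proj₂ extension) (suc i))))
        (≈₃-refl (ℤ.- ∂ p q x (suc i))))
        (≈₃-reflexive (cancelʳ (β i) (∂ p q x (suc i))))))
      where
      cancelˡ : ∀ a b → (a ℤ.+ b) ℤ.- a ≡ b
      cancelˡ = solve-∀
      cancelʳ : ∀ a b → (a ℤ.+ b) ℤ.- b ≡ a
      cancelʳ = solve-∀
      x+y : ∀ s x → x ℤ.+ (s ℤ.- x) ≡ s
      x+y = solve-∀

distinct⇒1< : ∀ {n} {i j : Fin n} → i ≢ j → 1 < n
distinct⇒1< {1} {zero} {zero} i≢j = contradiction refl i≢j
distinct⇒1< {ℕ.suc (ℕ.suc n)} i≢j = s≤s (s≤s z≤n)

1<⇒distinct : ∀ {n} → 1 < n → ∃[ i ] ∃[ j ] _≢_ {A = Fin n} i j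
1<⇒distinct {ℕ.suc (ℕ.suc n)} _ = zero , suc zero , λ ()
1<⇒distinct {1} (s≤s ())

1<⇒another : ∀ {n} → 1 < n → (v : Fin n) → ∃[ w ] w ≢ v
1<⇒another 1<n v with 1<⇒distinct 1<n
... | i , j , i≢j with i ≟ v
...   | yes refl = j , i≢j ∘ sym
...   | no i≢v   = i , i≢v

-- Contracting a subgraph H of G

module Contract (G H : Graph) (H⊆G : IsSubgraph H G) where
  open IsSubgraph H⊆G

  Outside : Vertex G → Set
  Outside v = ¬ (∃[ j ] vertex j ≡ v)

  outside? : Decidable Outside
  outside? v = ¬? (any? λ j → vertex j ≟ v)

  module C = Collapse outside?
  module S = Strip (C.collapse ∘ end₁ G) (C.collapse ∘ end₂ G)

  -- All of V(H) becomes `zero`. Every edge of `G` with both ends in V(H), whether in `H` or not,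
  -- turns into a loop and is stripped.
  contract : Graph
  contract = S.strip

  contract-order-< : Nontrivial H → order contract < order G
  contract-order-< 1<h with 1<⇒distinct 1<h
  ... | i , j , i≢j = injective⇒≤ {f = f} f-injective
    where
    -- Two vertices of `H` stand in for the single vertex `zero`, so the domain has one element more
    -- than the contraction.
    f : Fin (2 ℕ.+ C.cardinality) → Vertex G
    f zero          = vertex i
    f (suc zero)    = vertex j
    f (suc (suc l)) = C.index l
    f-injective : Injective _≡_ _≡_ f
    f-injective {zero}        {zero}        eq = refl
    f-injective {zero}        {suc zero}    eq = contradiction (vertex-injective eq) i≢j
    f-injective {zero}        {suc (suc l)} eq = contradiction (i , eq) (C.satisfied l)
    f-injective {suc zero}    {zero}        eq = contradiction (sym (vertex-injective eq)) i≢j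
    f-injective {suc zero}    {suc zero}    eq = refl
    f-injective {suc zero}    {suc (suc l)} eq = contradiction (j , eq) (C.satisfied l)
    f-injective {suc (suc l)} {zero}        eq = contradiction (i , sym eq) (C.satisfied l)
    f-injective {suc (suc l)} {suc zero}    eq = contradiction (j , sym eq) (C.satisfied l)
    f-injective {suc (suc k)} {suc (suc l)} eq = cong (λ l → suc (suc l)) (C.index-injective eq)

  collapse-surjective : ∀ w → ∃[ v ] C.collapse v ≡ w
  collapse-surjective zero    = vertex j , C.collapse-∉ (λ out → out (j , refl))
    where j = fromℕ< (nonempty H)
  collapse-surjective (suc i) = C.index i , C.collapse-index i

  contract-edgeConnected : ∀ {k} → EdgeConnected G k → EdgeConnected contract k
  contract-edgeConnected ec = cutBound⇒edgeConnected contract λ b (u , bu) (v , bv) →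
    subst (_ ≤_) (sym (S.cut-strip b))
      (edgeConnected⇒cutBound G ec (b ∘ C.collapse)
        (proj₁ (collapse-surjective u) , trans (cong b (proj₂ (collapse-surjective u))) bu)
        (proj₁ (collapse-surjective v) , trans (cong b (proj₂ (collapse-surjective v))) bv))

  ∂ᴳ : (Edge G → ℤ) → Vertex G → ℤ
  ∂ᴳ = ∂ (end₁ G) (end₂ G)

  -- Edges of `H` have both ends in V(H), so their values do not affect the boundary elsewhere.
  ∂ᴳ-outside : ∀ {x y v} → Outside v → (∀ e → (∀ j → edge j ≢ e) → x e ≡ y e) → ∂ᴳ x v ≡ ∂ᴳ y v
  ∂ᴳ-outside {x} {y} {v} out x≗y = ℤΣ.sum-cong-≗ λ e → pointwise e (any? λ j → edge j ≟ e)
    where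
    pointwise : ∀ e → Dec (∃[ j ] edge j ≡ e) →
      flow (end₁ G e) (end₂ G e) (x e) v ≡ flow (end₁ G e) (end₂ G e) (y e) v
    pointwise e (no e∉)          = cong (λ z → flow (end₁ G e) (end₂ G e) z v) (x≗y e (λ j eq → e∉ (j , eq)))
    pointwise _ (yes (j , refl)) = trans (flow-off _ ≢₁ ≢₂) (sym (flow-off _ ≢₁ ≢₂))
      where
      ≢₁ : end₁ G (edge j) ≢ v
      ≢₁ eq = out (end₁ H j , trans (sym (end₁-preserved j)) eq)
      ≢₂ : end₂ G (edge j) ≢ v
      ≢₂ eq = out (end₂ H j , trans (sym (end₂-preserved j)) eq)

  ∂ᴳ-vertex : ∀ y j → ∂ᴳ (override edge y (const 0ℤ)) (vertex j) ≡ ∂ (end₁ H) (end₂ H) y j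
  ∂ᴳ-vertex y j = trans
    (ℤΣ.sum-injection edge edge-injective _ λ e e∉ → trans
      (cong (λ z → flow (end₁ G e) (end₂ G e) z (vertex j)) (override-∉ edge y (const 0ℤ) e∉))
      (flowᵇ-zero (does (end₁ G e ≟ vertex j)) (does (end₂ G e ≟ vertex j))))
    (ℤΣ.sum-cong-≗ λ e → trans
      (cong (λ z → flow (end₁ G (edge e)) (end₂ G (edge e)) z (vertex j))
            (override-∈ edge edge-injective y (const 0ℤ) e))
      (flow-cong (y e)
        (λ eq → vertex-injective (trans (sym (end₁-preserved e)) eq))
        (λ eq → trans (end₁-preserved e) (cong vertex eq))
        (λ eq → vertex-injective (trans (sym (end₂-preserved e)) eq))
        (λ eq → trans (end₂-preserved e) (cong vertex eq))))

  -- The orientation of the contraction pulls back to `D₀`, which is correct modulo 3 outside `H`.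
  -- With the edges of `H` set to 0, the defect `g` vanishes modulo 3 outside `H` and has total 0
  -- modulo 3. So it restricts to a zero-sum function of `H`, and an orientation of `H` realising it
  -- replaces `D₀` on the edges of `H`.
  contract-lift : ℤ₃-Connected H → ℤ₃-Connected contract → ℤ₃-Connected G
  contract-lift H-connected contract-connected β β-zeroSum = D , D-orients
    where
    βᶜ : Vertex contract → ℤ
    -- The value that makes the total vanish.
    βᶜ zero    = ℤ.- ℤΣ.sum (β ∘ C.index)
    βᶜ (suc i) = β (C.index i)

    orientationᶜ : ∃[ D ] IsOrientationFor contract βᶜ D
    orientationᶜ = contract-connected βᶜ
      (unmod₃ (≈₃-reflexive (ℤ.+-inverseˡ (ℤΣ.sum (β ∘ C.index)))))

    Dᶜ : Orientation contract
    Dᶜ = proj₁ orientationᶜ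

    D₀ : Orientation G
    -- `const true` directs the stripped edges, whose ends are both in V(H); those of them outside
    -- `H` contribute to the defect `g`.
    D₀ = override S.index Dᶜ (const true)

    D₀-outside : ∀ {v} → Outside v → ∂ᴳ (sign ∘ D₀) v ≈₃ β v
    D₀-outside {v} out with C.position out
    ... | i , refl = ≈₃-trans
      (≈₃-reflexive (trans (sym (C.∂-collapse (end₁ G) (end₂ G) (sign ∘ D₀) i))
        (trans (sym (S.∂-strip (sign ∘ D₀) (suc i)))
        (trans (ℤΣ.sum-cong-≗ λ e → cong (λ b → flow (end₁ contract e) (end₂ contract e) (sign b) (suc i))
                                         (override-∈ S.index S.index-injective Dᶜ (const true) e))
               (sym (netDegree-∂ contract (total contract Dᶜ) (suc i)))))))
      (mod₃ (proj₂ orientationᶜ (suc i)))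

    x₀ : Edge G → ℤ
    x₀ = override edge (const 0ℤ) (sign ∘ D₀)

    g : Vertex G → ℤ
    g v = β v ℤ.- ∂ᴳ x₀ v

    g-outside : ∀ v → (∀ j → vertex j ≢ v) → g v ≈₃ 0ℤ
    g-outside v v∉ = ≈₃-trans
      (≈₃-+-cong
        (≈₃-trans (≈₃-sym (D₀-outside out))
          (≈₃-reflexive (∂ᴳ-outside out λ e e∉ → sym (override-∉ edge (const 0ℤ) (sign ∘ D₀) e∉))))
        (≈₃-refl (ℤ.- ∂ᴳ x₀ v)))
      (≈₃-reflexive (ℤ.+-inverseʳ (∂ᴳ x₀ v)))
      where
      out : Outside v
      out (j , eq) = v∉ j eq

    orientationᴴ : ∃[ D ] IsOrientationFor H (g ∘ vertex) D
    orientationᴴ = H-connected (g ∘ vertex) (unmod₃ (≈₃-trans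
      (≈₃-sym (ℤ₃Σ.sum-injection vertex vertex-injective g g-outside))
      (≈₃-trans (≈₃-reflexive (trans (sum-minus β (∂ᴳ x₀))
          (trans (cong (ℤ._-_ (ℤΣ.sum β)) (∂-total (end₁ G) (end₂ G) x₀)) (ℤ.+-identityʳ (ℤΣ.sum β)))))
        (mod₃ {b = 0ℤ} β-zeroSum))))

    Dᴴ : Orientation H
    Dᴴ = proj₁ orientationᴴ

    D : Orientation G
    D = override edge Dᴴ D₀

    x₁ : Edge G → ℤ
    x₁ = override edge (sign ∘ Dᴴ) (const 0ℤ)

    D-split : ∀ e → sign (D e) ≡ x₀ e ℤ.+ x₁ e
    D-split e = cases (any? λ j → edge j ≟ e)
      where
      cases : Dec (∃[ j ] edge j ≡ e) → sign (D e) ≡ x₀ e ℤ.+ x₁ e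
      cases (yes (j , refl)) = trans (cong sign (override-∈ edge edge-injective Dᴴ D₀ j))
        (trans (sym (ℤ.+-identityˡ (sign (Dᴴ j))))
          (sym (cong₂ ℤ._+_ (override-∈ edge edge-injective (const 0ℤ) (sign ∘ D₀) j)
                            (override-∈ edge edge-injective (sign ∘ Dᴴ) (const 0ℤ) j))))
      cases (no e∉) = trans (cong sign (override-∉ edge Dᴴ D₀ e∉′))
        (trans (sym (ℤ.+-identityʳ (sign (D₀ e))))
          (sym (cong₂ ℤ._+_ (override-∉ edge (const 0ℤ) (sign ∘ D₀) e∉′)
                            (override-∉ edge (sign ∘ Dᴴ) (const 0ℤ) e∉′))))
        where
        e∉′ : ∀ j → edge j ≢ e
        e∉′ j eq = e∉ (j , eq)

    D-inside : ∀ j → ∂ᴳ (sign ∘ D) (vertex j) ≈₃ β (vertex j)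
    D-inside j = ≈₃-trans
      (≈₃-reflexive (trans
        (ℤΣ.sum-cong-≗ λ e → cong (λ z → flow (end₁ G e) (end₂ G e) z (vertex j)) (D-split e))
        (trans (∂-+ (end₁ G) (end₂ G) x₀ x₁ (vertex j))
          (cong (ℤ._+_ (∂ᴳ x₀ (vertex j))) (trans (∂ᴳ-vertex (sign ∘ Dᴴ) j)
            (sym (netDegree-∂ H (total H Dᴴ) j)))))))
      (≈₃-trans (≈₃-+-cong (≈₃-refl (∂ᴳ x₀ (vertex j))) (mod₃ (proj₂ orientationᴴ j)))
        (≈₃-reflexive (cancel (∂ᴳ x₀ (vertex j)) (β (vertex j)))))
      where
      cancel : ∀ a b → a ℤ.+ (b ℤ.- a) ≡ b
      cancel = solve-∀

    ∂ᴳ-D : ∀ v → Dec (∃[ j ] vertex j ≡ v) → ∂ᴳ (sign ∘ D) v ≈₃ β v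
    ∂ᴳ-D _ (yes (j , refl)) = D-inside j
    ∂ᴳ-D _ (no out)         = ≈₃-trans
      (≈₃-reflexive (∂ᴳ-outside out λ e e∉ → cong sign (override-∉ edge Dᴴ D₀ e∉)))
      (D₀-outside out)

    D-orients : IsOrientationFor G β D
    D-orients v = unmod₃ (≈₃-trans (≈₃-reflexive (netDegree-∂ G (total G D) v))
      (∂ᴳ-D v (any? λ j → vertex j ≟ v)))

-- Induction by contraction, from (B) to (C)

orientable? : ∀ G β → Dec (∃[ D ] IsOrientationFor G β D)
orientable? G β = map′
  (λ (S , orients) → lookup S , orients)
  (λ (D , orients) → tabulate D , λ v → subst (_≡₃ β v) (net-tabulate D v) (orients v))
  -- An orientation is a Boolean vector indexed by the edges, that is, a `Subset`; there are
  -- finitely many.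
  (anySubset? λ S → all? λ v → + 3 ∣? (netDegree G (total G (lookup S)) v ℤ.- β v))
  where
  net-tabulate : ∀ D v → netDegree G (total G D) v ≡ netDegree G (total G (lookup (tabulate D))) v
  net-tabulate D v = trans (netDegree-∂ G (total G D) v) (trans
    (ℤΣ.sum-cong-≗ λ e → cong (λ b → flow (end₁ G e) (end₂ G e) (sign b) v) (sym (lookup∘tabulate D e)))
    (sym (netDegree-∂ G (total G (lookup (tabulate D))) v)))

-- On at most one vertex a function equals its own total, so every boundary is 0 and `β` is 0 modulo
-- 3.
trivial⇒ℤ₃-Connected : ∀ G → order G ≤ 1 → ℤ₃-Connected G
trivial⇒ℤ₃-Connected G ≤1 β β-zeroSum = const true , λ v → unmod₃ (≈₃-trans
  (≈₃-reflexive (trans (netDegree-∂ G (total G (const true)) v)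
    (trans (value-sum ≤1 _ v) (∂-total (end₁ G) (end₂ G) (const 1ℤ)))))
  (≈₃-trans (≈₃-sym (mod₃ {b = 0ℤ} β-zeroSum)) (≈₃-reflexive (sym (value-sum ≤1 β v)))))
  where
  value-sum : ∀ {n} → n ≤ 1 → (f : Fin n → ℤ) → ∀ v → f v ≡ ℤΣ.sum f
  value-sum (s≤s z≤n) f zero = sym (ℤ.+-identityʳ (f zero))

edgeConnected⇒≤degree : ∀ G {k} → Nontrivial G → EdgeConnected G k → ∀ v → k ≤ degree G v
edgeConnected⇒≤degree G 1<n ec v with 1<⇒another 1<n v
... | w , w≢v = subst (_ ≤_) (sym (degree-cut G v)) (edgeConnected⇒cutBound G ec _
  (v , dec-true (v ≟ v) refl) (w , dec-false (w ≟ v) w≢v))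

≤degree⇒≤minDegree : ∀ G {k} → (∀ v → k ≤ degree G v) → k ≤ minDegree G
≤degree⇒≤minDegree G k≤ = v≤min⁺ (k≤ _) (All.map⁺ (All.tabulate⁺ k≤))

reducedMinDegree⇒edgeConnected⇒ℤ₃-Connected :
  (∀ G → ℤ₃-Reduced G → minDegree G ≤ 4) → ∀ G → EdgeConnected G 5 → ℤ₃-Connected G
reducedMinDegree⇒edgeConnected⇒ℤ₃-Connected B G = go G (<-wellFounded (order G))
  where
  go : ∀ G → Acc _<_ (order G) → EdgeConnected G 5 → ℤ₃-Connected G
  go G (acc rec) ec β β-zeroSum with 1 ℕ.<? order G
  ... | no 1≮n  = trivial⇒ℤ₃-Connected G (ℕ.≮⇒≥ 1≮n) β β-zeroSum
  -- Any nontrivial ℤ₃-connected subgraph would yield an orientation for this `β`. If there is none,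
  -- `G` is therefore reduced, and (B) contradicts all degrees being at least 5.
  ... | yes 1<n = decidable-stable (orientable? G β) λ ¬orientable →
    ℕ.<⇒≱ (≤degree⇒≤minDegree G (edgeConnected⇒≤degree G 1<n ec))
      (B G λ H H⊆G H-nontrivial H-connected →
        let open Contract G H H⊆G in
        ¬orientable (contract-lift H-connected
          (go contract (rec (contract-order-< H-nontrivial)) (contract-edgeConnected ec))
          β β-zeroSum))

-- The closure of a set S of vertices: the complement of S is collapsed to zero, and parallel
-- edges between zero and a vertex of S raise the degree of zero to five.

module Closure (G : Graph) (S : Subset (order G)) {s₀ s₁ : Vertex G}
  (s₀∈S : s₀ ∈ S) (s₁∈S : s₁ ∈ S) (s₀≢s₁ : s₀ ≢ s₁) (cut≤5 : cutSize G S ≤ 5) where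

  module C = Collapse (_∈? S)

  n : ℕ
  n = C.cardinality

  s : Fin n
  s = proj₁ (C.position s₀∈S)

  1<n : 1 < n
  1<n = distinct⇒1< {i = s} {proj₁ (C.position s₁∈S)} λ eq → s₀≢s₁
    (trans (sym (proj₂ (C.position s₀∈S))) (trans (cong C.index eq) (proj₂ (C.position s₁∈S))))

  -- By `cut≤5` the truncated subtraction is exact. All extra edges join `zero` to the one vertex
  -- `s`.
  extra : ℕ
  extra = 5 ∸ cutSize G S

  p⊎ q⊎ : Fin extra ⊎ Edge G → Fin (ℕ.suc n)
  p⊎ = [ const zero , C.collapse ∘ end₁ G ]′
  q⊎ = [ const (suc s) , C.collapse ∘ end₂ G ]′

  p q : Fin (extra ℕ.+ size G) → Fin (ℕ.suc n)
  p = p⊎ ∘ splitAt extra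
  q = q⊎ ∘ splitAt extra

  module T = Strip p q

  closure : Graph
  closure = T.strip

  cutᴳ : (Vertex G → Bool) → ℕ
  cutᴳ = cut (end₁ G) (end₂ G)

  cut-closure : ∀ b → cut p q b
    ≡ ℕΣ.sum {extra} (const (𝟙 (b zero xor b (suc s)))) ℕ.+ cutᴳ (b ∘ C.collapse)
  cut-closure b = sum-splitAt extra (λ e → 𝟙 (b (p⊎ e) xor b (q⊎ e)))

  cutᴳ≤cut : ∀ b → cutᴳ (b ∘ C.collapse) ≤ cut p q b
  cutᴳ≤cut b = subst (cutᴳ (b ∘ C.collapse) ≤_) (sym (cut-closure b)) (ℕ.m≤n+m _ _)

  -- The edges leaving `S` and the extra edges together number 5.
  cut-zero : ∀ {b} → b zero ≡ false → (∀ j → b (suc j) ≡ true) → cut p q b ≡ 5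
  cut-zero {b} b0 bs = trans (cut-closure b) (trans
    (cong₂ ℕ._+_
      (trans (ℕΣ.sum-cong-≗ {extra} λ _ → cong₂ (λ s t → 𝟙 (s xor t)) b0 (bs s)) (sum-ones extra))
      (trans (cut-cong (end₁ G) (end₂ G) b-collapse) (sym (cutSize-cut G S))))
    (ℕ.m∸n+n≡m cut≤5))
    where
    b-collapse : ∀ v → b (C.collapse v) ≡ lookup S v
    b-collapse v with v ∈? S
    ... | yes v∈S = trans (bs _) (sym ([]=⇒lookup v∈S))
    ... | no v∉S  = trans b0 (sym (∉-lookup v∉S))

  closure-degree-zero : degree closure zero ≡ 5
  closure-degree-zero = trans (degree-cut closure zero) (trans (T.cut-strip isZero)
    (trans (sym (cut-not p q isZero)) (cut-zero {not ∘ isZero} refl λ j → refl)))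
    where
    isZero : Fin (ℕ.suc n) → Bool
    isZero v = does (v ≟ zero)

  module Delete₀ = Delete (p ∘ T.index) (q ∘ T.index) T.satisfied (ℕ.<-trans ℕ.0<1+n 1<n)
  open Delete₀ using (delete) public

  -- The extra edges all end at `zero`, so every edge that survives its deletion comes from an edge
  -- of `G` with both ends in `S`.
  delete⊆G : IsSubgraph delete G
  delete⊆G = record
    { vertex           = C.index
    ; edge             = proj₁ ∘ original
    ; vertex-injective = C.index-injective
    ; edge-injective   = λ {i} {j} eq → Delete₀.index-injective (T.index-injective
        (trans (sym (proj₂ (original i))) (trans (cong (extra ↑ʳ_) eq) (proj₂ (original j)))))
    ; end₁-preserved   = λ j → sym (C.collapse-suc (trans (sym (p-original (proj₁ (original j))))
        (trans (cong p (proj₂ (original j))) (sym (Delete₀.suc-p′ j)))))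
    ; end₂-preserved   = λ j → sym (C.collapse-suc (trans (sym (q-original (proj₁ (original j))))
        (trans (cong q (proj₂ (original j))) (sym (Delete₀.suc-q′ j)))))
    }
    where
    p-original : ∀ e → p (extra ↑ʳ e) ≡ C.collapse (end₁ G e)
    p-original e = cong p⊎ (splitAt-↑ʳ extra (size G) e)
    q-original : ∀ e → q (extra ↑ʳ e) ≡ C.collapse (end₂ G e)
    q-original e = cong q⊎ (splitAt-↑ʳ extra (size G) e)

    p≢zero⇒original : ∀ i → p i ≢ zero → ∃[ e ] extra ↑ʳ e ≡ i
    p≢zero⇒original i p≢0 with splitAt extra i in eq
    ... | inj₁ _ = contradiction refl p≢0
    ... | inj₂ e = e , splitAt⁻¹-↑ʳ eq

    original : ∀ j → ∃[ e ] extra ↑ʳ e ≡ T.index (Delete₀.index j)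
    original j = p≢zero⇒original _ (Delete₀.satisfied j ∘ inj₁)

  module Minimal
    (5≤degree : ∀ v → 5 ≤ degree G v)
    (minimal : ∀ T → T ⊂ S → ∀ {u v} → u ∈ T → v ∈ T → u ≢ v → 6 ≤ cutSize G T)
    where

    -- The side coloured `true` amounts to a set T of vertices of `S`. If T has two elements and is
    -- not all of `S`, minimality applies. If T is all of `S`, the cut has 5 edges and isolates
    -- `zero`. If T is a singleton, the cut has at least as many edges as its vertex has in `G`.
    classify-avoiding-zero : ∀ b → b zero ≡ false → ∀ i → b (suc i) ≡ true →
      6 ≤ cut p q b ⊎ (5 ≤ cut p q b × IsolatesVertex b)
    classify-avoiding-zero b b0 i bi
      with any? (λ j → ¬? (j ≟ i) ×-dec (b (suc j) Bool.≟ true)) | any? (λ k → b (suc k) Bool.≟ false)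
    ... | yes (j , j≢i , bj) | yes (k , bk) = inj₁ (ℕ.≤-trans
      (subst (6 ≤_) (cutSize-tabulate G c) (minimal (tabulate c) T⊂S
        (∈-tabulate c (index-∈ bi)) (∈-tabulate c (index-∈ bj))
        (λ eq → j≢i (sym (C.index-injective eq)))))
      (cutᴳ≤cut b))
      where
      c : Vertex G → Bool
      c = b ∘ C.collapse
      index-∈ : ∀ {j} → b (suc j) ≡ true → c (C.index j) ≡ true
      index-∈ {j} = trans (cong b (C.collapse-index j))
      T⊂S : tabulate c ⊂ S
      T⊂S = (λ {v} v∈T → decidable-stable (v ∈? S) λ v∉S → contradiction
              (trans (sym (tabulate-∈ c v∈T)) (trans (cong b (C.collapse-∉ v∉S)) b0)) λ ())
          , C.index k , C.satisfied k , λ k∈T → contradiction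
              (trans (sym (tabulate-∈ c k∈T)) (trans (cong b (C.collapse-index k)) bk)) λ ()
    ... | yes _ | no all = inj₂ (ℕ.≤-reflexive (sym (cut-zero {b} b0 b-suc)) , zero , isolates)
      where
      b-suc : ∀ k → b (suc k) ≡ true
      b-suc k = ¬-not λ bk → all (k , bk)
      isolates : ∀ v → v ≢ zero → b v ≢ b zero
      isolates zero    v≢0 = contradiction refl v≢0
      isolates (suc k) _ eq = contradiction (trans (sym (b-suc k)) (trans eq b0)) λ ()
    ... | no only | _ = inj₂
      ( ℕ.≤-trans (subst (5 ≤_) degree≡cut (5≤degree (C.index i))) (cutᴳ≤cut b)
      , suc i , isolates )
      where
      b-other : ∀ {j} → j ≢ i → b (suc j) ≡ false
      b-other {j} j≢i = ¬-not λ bj → only (j , j≢i , bj)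
      isolates : ∀ v → v ≢ suc i → b v ≢ b (suc i)
      isolates zero    _ eq = contradiction (trans (sym b0) (trans eq bi)) λ ()
      isolates (suc j) j≢i eq =
        contradiction (trans (sym (b-other (j≢i ∘ cong suc))) (trans eq bi)) λ ()
      -- Pulled back along the collapse, the cut is the one around the single vertex `C.index i` of
      -- `G`.
      indicator : ∀ v → does (v ≟ C.index i) ≡ b (C.collapse v)
      indicator v with C.collapse v in eq
      ... | zero  = trans (dec-false (v ≟ C.index i) λ { refl → 0≢1+n (trans (sym eq) (C.collapse-index i)) })
                          (sym b0)
      ... | suc j with j ≟ i
      ...   | yes refl = trans (dec-true (v ≟ C.index j) (sym (C.collapse-suc eq))) (sym bi)
      ...   | no j≢i   = trans (dec-false (v ≟ C.index i) λ { refl →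
                           j≢i (suc-injective (trans (sym eq) (C.collapse-index i))) })
                         (sym (b-other j≢i))
      degree≡cut : degree G (C.index i) ≡ cutᴳ (b ∘ C.collapse)
      degree≡cut = trans (degree-cut G (C.index i)) (cut-cong (end₁ G) (end₂ G) indicator)

    -- Swapping the two colours keeps the cut, so the side coloured `true` may be taken to avoid
    -- `zero`.
    classify : ∀ b → ∃[ u ] b u ≡ true → ∃[ v ] b v ≡ false →
      6 ≤ cut p q b ⊎ (5 ≤ cut p q b × IsolatesVertex b)
    classify b (u , bu) (v , bv) with b zero in b0
    classify b (zero , bu)  _            | false = contradiction (trans (sym bu) b0) λ ()
    classify b (suc i , bi) _            | false = classify-avoiding-zero b b0 i bi
    classify b _            (zero , bv)  | true  = contradiction (trans (sym b0) bv) λ ()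
    classify b _            (suc i , bi) | true  =
      [ inj₁ ∘ subst (6 ≤_) (cut-not p q b)
      , (λ (5≤ , iso) → inj₂ (subst (5 ≤_) (cut-not p q b) 5≤ , isolatesVertex-not iso)) ]′
      (classify-avoiding-zero (not ∘ b) (cong not b0) i (cong not bi))

    closure-cutBound : CutBound (end₁ closure) (end₂ closure) 5
    closure-cutBound b u v = subst (5 ≤_) (sym (T.cut-strip b))
      ([ ℕ.≤-trans (ℕ.n≤1+n 5) , proj₁ ]′ (classify b u v))

    closure-edgeConnected : EdgeConnected closure 5
    closure-edgeConnected = cutBound⇒edgeConnected closure closure-cutBound

    closure-essentiallyEdgeConnected : EssentiallyEdgeConnected closure 6
    closure-essentiallyEdgeConnected R ((u , u∈R) , (v , v∈∁R)) essential =
      [ subst (6 ≤_) (sym (trans (cutSize-cut closure R) (T.cut-strip (lookup R))))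
      -- An essential cut that isolates a vertex has at least 5 + 5 = 6 + 4 edges.
      , (λ (_ , isolates) → ℕ.≤-trans (ℕ.m≤m+n 6 4)
          (essential-isolating-cut closure closure-cutBound R isolates essential)) ]′
      (classify (lookup R) (u , []=⇒lookup u∈R) (v , ∉-lookup (x∈∁p⇒x∉p v∈∁R)))

-- Descent to a minimal set with a small cut, from (A) to (B)

minDegree≤degree : ∀ G v → minDegree G ≤ degree G v
minDegree≤degree G v = min≤v⁺ _ (map (degree G) (allFin (order G)))
  (inj₂ (Any.map⁺ (Any.tabulate⁺ v ℕ.≤-refl)))

-- A positive count requires some edge to exist, and the ends of any edge are distinct.
positive-degree⇒nontrivial : ∀ G {v} → 0 < degree G v → Nontrivial G
positive-degree⇒nontrivial G {v} 0<d = distinct⇒1< (loopless G (first 0<d))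
  where
  first : ∀ {m} {f : Fin m → ℕ} → 0 < ℕΣ.sum f → Fin m
  first {ℕ.suc m} _ = zero

cutSize-⊤ : ∀ G → cutSize G Subset.⊤ ≡ 0
cutSize-⊤ G = trans (cutSize-cut G Subset.⊤) (ℕΣ.sum-zero λ e →
  cong₂ (λ s t → 𝟙 (s xor t)) (lookup-replicate (end₁ G e) true) (lookup-replicate (end₂ G e) true))

extendable⇒reducedMinDegree :
  (∀ G → EdgeConnected G 5 → EssentiallyEdgeConnected G 6 →
    ∀ z → degree G z ≡ 5 → ℤ₃-ExtendableAt G z) →
  ∀ G → ℤ₃-Reduced G → minDegree G ≤ 4
extendable⇒reducedMinDegree A G reduced = ℕ.≮⇒≥ λ 5≤δ →
  let 5≤degree = λ v → ℕ.≤-trans 5≤δ (minDegree≤degree G v)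
      1<n = positive-degree⇒nontrivial G (ℕ.<-≤-trans ℕ.0<1+n (5≤degree (fromℕ< (nonempty G))))
      _ , _ , u≢v = 1<⇒distinct 1<n
  in no-small-cut 5≤degree Subset.⊤ (⊂-wellFounded Subset.⊤) ∈⊤ ∈⊤ u≢v
       (subst (_≤ 5) (sym (cutSize-⊤ G)) z≤n)
  where
  -- Induction along proper inclusion replaces the choice of a minimal `S`: the induction hypothesis
  -- is the minimality that `Minimal` asks for. Applied to V(G), whose cut is empty, it gives the
  -- contradiction.
  no-small-cut : (∀ v → 5 ≤ degree G v) → ∀ S → Acc _⊂_ S →
    ∀ {u v} → u ∈ S → v ∈ S → u ≢ v → ¬ cutSize G S ≤ 5
  no-small-cut 5≤degree S (acc rec) u∈S v∈S u≢v cut≤5 =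
    reduced delete delete⊆G 1<n (Delete₀.extendable⇒delete-connected
      (A closure closure-edgeConnected closure-essentiallyEdgeConnected zero closure-degree-zero))
    where
    open Closure G S u∈S v∈S u≢v cut≤5
    open Minimal 5≤degree (λ T T⊂S u∈T v∈T u≢v →
      ℕ.≰⇒> (no-small-cut 5≤degree T (rec T⊂S) u∈T v∈T u≢v))

proposition3p3 : ( (∀ G → EdgeConnected G 5 → EssentiallyEdgeConnected G 6 →
    ∀ z → degree G z ≡ 5 → ℤ₃-ExtendableAt G z)
    → (∀ G → ℤ₃-Reduced G → minDegree G ≤ 4) )
    ×
    ( (∀ G → ℤ₃-Reduced G → minDegree G ≤ 4)
    → (∀ G → EdgeConnected G 5 → ℤ₃-Connected G) )
proposition3p3 = extendable⇒reducedMinDegree , reducedMinDegree⇒edgeConnected⇒ℤ₃-Connected
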